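{- Let $s_l=(a_j)$, $1\le j\le l$, be an ordered string of non-negative integers, and let $n$ be greater than or equal to the order of the Kyle graph associated with $s_l$. Then $\Delta(O_n(s_l))=2\,\delta(O_n(s_l))$.
   Context: An ordered string $s_l=(a_j)$, $1\le j\le l$ ($l\ge 1$), is an $l$-tuple of non-negative integers; $j$ is the index of the entry $a_j$. For a positive integer $n$, the ornated graph $O_n(s_l)$ is the (in general non-simple) directed graph on vertices $v_1,\dots,v_n$ whose arcs, counted with multiplicity, are the following: each odd-indexed entry $a_t$ contributes one arc $(v_i,v_j)$ for every pair $i<j$ with $i+a_t\ge j$; each even-indexed entry $a_s$ contributes one arc $(v_i,v_j)$ for every pair $i>j$ with $i-a_s\le j$. The degree of a vertex is $d(v)=d^+(v)+d^-(v)$ (out-degree plus in-degree, with multiplicity); $\Delta(O_n(s_l))$ and $\delta(O_n(s_l))$ are the maximum and minimum degree. The maximum possible degree associated with $s_l$ is $\max_{n\ge 1}\Delta(O_n(s_l))$. The Kyle graph associated with $s_l$ is the ornated graph $O_n(s_l)$ of smallest order $n$ that has a vertex of this maximum possible degree. -}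

module Defs where

open import Data.Bool.Base using (if_then_else_)
open import Data.Fin.Base using (Fin; toℕ)
open import Data.Nat.Base using (ℕ; suc; _+_; _∸_; _≤_; _<_; _⊔_; _⊓_; NonZero)
open import Data.Nat.Divisibility using (_∣_; _∤_; _∣?_)
open import Data.Nat.Properties using (_≤?_; _<?_; +-0-commutativeMonoid)
open import Data.Product.Base using (_×_; ∃-syntax)
open import Data.Sum.Base using (_⊎_)
open import Data.Vec.Base using (Vec; lookup; tabulate; foldr₁)
open import Relation.Binary.PropositionalEquality.Core using (_≡_)
open import Relation.Nullary.Decidable using (Dec; does; ¬?; _×-dec_; _⊎-dec_)

open import Algebra.Properties.CommutativeMonoid.Sum +-0-commutativeMonoid using (sum)

-- A directed multigraph on n vertices: G u v is the multiplicity of the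
-- arc (u , v).
MultiDigraph : ℕ → Set
MultiDigraph n = Fin n → Fin n → ℕ

module _ {n : ℕ} (G : MultiDigraph n) where

  outDegree : Fin n → ℕ
  outDegree v = sum λ u → G v u

  inDegree : Fin n → ℕ
  inDegree v = sum λ u → G u v

  degree : Fin n → ℕ
  degree v = outDegree v + inDegree v

  HasVertexOfDegree : ℕ → Set
  HasVertexOfDegree d = ∃[ v ] degree v ≡ d

Δ : ∀ {n} .⦃ _ : NonZero n ⦄ → MultiDigraph n → ℕ
Δ {suc _} G = foldr₁ _⊔_ (tabulate (degree G))

δ : ∀ {n} .⦃ _ : NonZero n ⦄ → MultiDigraph n → ℕ
δ {suc _} G = foldr₁ _⊓_ (tabulate (degree G))

OrderedString : ℕ → Set
OrderedString l = Vec ℕ l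

-- Entries of a string and vertices v₁, …, vₙ are numbered from 1.
index : ∀ {n} → Fin n → ℕ
index i = suc (toℕ i)

-- Whether the entry a of index t contributes an arc (vᵢ , vⱼ).
-- Truncated subtraction is harmless: i ∸ a ≤ j iff i - a ≤ j in ℤ, as j ≥ 0.
ContributesArc : (t a i j : ℕ) → Set
ContributesArc t a i j =
  (2 ∤ t × i < j × j ≤ i + a) ⊎ (2 ∣ t × j < i × i ∸ a ≤ j)

contributesArc? : ∀ t a i j → Dec (ContributesArc t a i j)
contributesArc? t a i j =
  (¬? (2 ∣? t) ×-dec i <? j ×-dec j ≤? i + a)
    ⊎-dec
  (2 ∣? t ×-dec j <? i ×-dec i ∸ a ≤? j)

O : ∀ n {l} → OrderedString l → MultiDigraph n
O n s u v = sum λ t →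
  if does (contributesArc? (index t) (lookup s t) (index u) (index v)) then 1 else 0

-- D = max { Δ (O n s) | n ≥ 1 }, a maximum over infinitely many orders.
record IsMaxPossibleDegree {l} (s : OrderedString l) (D : ℕ) : Set where
  field
    order       : ℕ
    ⦃ nonZero ⦄ : NonZero order
    attained    : Δ (O order s) ≡ D
    bound       : ∀ n .⦃ _ : NonZero n ⦄ → Δ (O n s) ≤ D

record IsKyleOrder {l} (s : OrderedString l) (k : ℕ) : Set where
  field
    maxDegree           : ℕ
    isMaxPossibleDegree : IsMaxPossibleDegree s maxDegree
    ⦃ nonZero ⦄         : NonZero k
    attained            : HasVertexOfDegree (O k s) maxDegree
    smallest            : ∀ m .⦃ _ : NonZero m ⦄ →
                          HasVertexOfDegree (O m s) maxDegree → k ≤ m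

{-# OPTIONS --safe #-}

-- An entry a joins vᵢ to the a nearest vertices on either side, whatever the
-- parity of its index, so it contributes min(a, i - 1) + min(a, n - i) to the
-- degree of vᵢ.  Hence d(vᵢ) = f(i - 1) + f(n - i), where f(x) = Σₜ min(aₜ, x)
-- is monotone, subadditive and bounded by M = Σₜ aₜ, with f(0) = 0.  The
-- maximum possible degree is 2M, so the Kyle graph has a vertex with
-- f(i - 1) = M = f(k - i).  For n ≥ k the same vertex still has degree 2M, and
-- f(n - 1) = M.  Thus v₁ has degree f(0) + f(n - 1) = M, and this is minimal
-- because f(i - 1) + f(n - i) ≥ f(n - 1).
module Submission where

open import Data.Bool.Base using (if_then_else_)
open import Data.Fin.Base using (Fin; zero; suc; toℕ; fromℕ<; inject≤)
open import Data.Fin.Properties using (toℕ<n; toℕ-fromℕ<; toℕ-inject≤)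
open import Data.Nat.Base using (ℕ; zero; suc; z≤n; s≤s; _+_; _*_; _∸_; _≤_; _<_; _⊔_; _⊓_; NonZero)
open import Data.Nat.Divisibility using (_∣_; _∤_; _∣?_)
open import Data.Nat.Properties
open import Data.Product.Base using (_×_; _,_)
open import Data.Sum.Base using (inj₁; inj₂)
open import Data.Vec.Base using (lookup; tabulate; foldr₁)
open import Function.Base using (_∘_)
open import Function.Bundles using (_⇔_; mk⇔)
open import Relation.Binary.PropositionalEquality.Core using (_≡_; refl; sym; trans; cong; cong₂; subst)
open import Relation.Binary.PropositionalEquality.Properties using (module ≡-Reasoning)
open import Relation.Nullary.Decidable using (Dec; yes; no; does; does-⇔; _×-dec_)
open import Relation.Nullary.Negation using (contradiction)
open import Algebra.Properties.CommutativeMonoid.Sum +-0-commutativeMonoid using (sum; sum-cong-≗; sum-replicate-zero; ∑-comm; ∑-distrib-+)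
open import Defs

-- Finite sums, truncation, and extrema of tabulated functions.

sum-mono-≤ : ∀ {n} {f g : Fin n → ℕ} → (∀ i → f i ≤ g i) → sum f ≤ sum g
sum-mono-≤ {zero}  f≤g = z≤n
sum-mono-≤ {suc n} f≤g = +-mono-≤ (f≤g zero) (sum-mono-≤ (f≤g ∘ suc))

term≤sum : ∀ {n} (f : Fin n → ℕ) i → f i ≤ sum f
term≤sum f zero    = m≤m+n _ _
term≤sum f (suc i) = ≤-trans (term≤sum (f ∘ suc) i) (m≤n+m _ (f zero))

⊓-subadditiveʳ : ∀ a x y → a ⊓ (x + y) ≤ a ⊓ x + a ⊓ y
⊓-subadditiveʳ zero    x       y = z≤n
⊓-subadditiveʳ (suc a) zero    y = ≤-refl
⊓-subadditiveʳ (suc a) (suc x) y = s≤s (≤-trans (⊓-subadditiveʳ a x y)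
  -- The recursion only yields `a ⊓ y`, which is at most `suc a ⊓ y`.
  (+-monoʳ-≤ (a ⊓ x) (⊓-monoˡ-≤ y (n≤1+n a))))

foldr₁-⊔-upper : ∀ {n} (f : Fin (suc n) → ℕ) i → f i ≤ foldr₁ _⊔_ (tabulate f)
foldr₁-⊔-upper {zero}  f zero    = ≤-refl
foldr₁-⊔-upper {suc n} f zero    = m≤m⊔n _ _
foldr₁-⊔-upper {suc n} f (suc i) = m≤n⇒m≤o⊔n (f zero) (foldr₁-⊔-upper (f ∘ suc) i)

foldr₁-⊔-least : ∀ {n d} (f : Fin (suc n) → ℕ) → (∀ i → f i ≤ d) → foldr₁ _⊔_ (tabulate f) ≤ d
foldr₁-⊔-least {zero}  f f≤d = f≤d zero
foldr₁-⊔-least {suc n} f f≤d = ⊔-lub (f≤d zero) (foldr₁-⊔-least (f ∘ suc) (f≤d ∘ suc))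

foldr₁-⊓-lower : ∀ {n} (f : Fin (suc n) → ℕ) i → foldr₁ _⊓_ (tabulate f) ≤ f i
foldr₁-⊓-lower {zero}  f zero    = ≤-refl
foldr₁-⊓-lower {suc n} f zero    = m⊓n≤m _ _
foldr₁-⊓-lower {suc n} f (suc i) = m≤n⇒o⊓m≤n (f zero) (foldr₁-⊓-lower (f ∘ suc) i)

foldr₁-⊓-greatest : ∀ {n d} (f : Fin (suc n) → ℕ) → (∀ i → d ≤ f i) → d ≤ foldr₁ _⊓_ (tabulate f)
foldr₁-⊓-greatest {zero}  f d≤f = d≤f zero
foldr₁-⊓-greatest {suc n} f d≤f = ⊓-glb (d≤f zero) (foldr₁-⊓-greatest (f ∘ suc) (d≤f ∘ suc))

-- Arcs and neighbours contributed by a single entry.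

private
  [_] : ∀ {P : Set} → Dec P → ℕ
  [ p? ] = if does p? then 1 else 0

  indicator-cong : ∀ {P Q : Set} (p? : Dec P) (q? : Dec Q) → P ⇔ Q → [ p? ] ≡ [ q? ]
  indicator-cong p? q? P⇔Q = cong (if_then 1 else 0) (does-⇔ P⇔Q p? q?)

-- The arc condition stripped of parity: odd indices give arcs in this direction, even indices in
-- the reverse one.
Follows : (a i j : ℕ) → Set
Follows a i j = i < j × j ≤ i + a

follows? : ∀ a i j → Dec (Follows a i j)
follows? a i j = i <? j ×-dec j ≤? i + a

odd-contributesArc : ∀ {t a i j} → 2 ∤ t → ContributesArc t a i j ⇔ Follows a i j
odd-contributesArc 2∤t = mk⇔
  (λ { (inj₁ (_ , p)) → p ; (inj₂ (2∣t , _)) → contradiction 2∣t 2∤t })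
  (λ p → inj₁ (2∤t , p))

even-contributesArc : ∀ {t a i j} → 2 ∣ t → ContributesArc t a i j ⇔ Follows a j i
even-contributesArc {t} {a} {i} {j} 2∣t = mk⇔
  (λ { (inj₁ (2∤t , _)) → contradiction 2∣t 2∤t
     ; (inj₂ (_ , j<i , i∸a≤j)) → j<i , subst (i ≤_) (+-comm a j)
         (≤-trans (m≤n+m∸n i a) (+-monoʳ-≤ a i∸a≤j)) })
  (λ { (j<i , i≤j+a) → inj₂ (2∣t , j<i , m≤n+o⇒m∸n≤o i a (subst (i ≤_) (+-comm j a) i≤j+a)) })

-- Parity only orients the arcs, so it disappears once both directions between two vertices are
-- added. For an even index the two summands change places.
arcs-between : ∀ t a i j →
  [ contributesArc? t a i j ] + [ contributesArc? t a j i ] ≡ [ follows? a i j ] + [ follows? a j i ]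
arcs-between t a i j with 2 ∣? t
... | no 2∤t = cong₂ _+_
  (indicator-cong (contributesArc? t a i j) (follows? a i j) (odd-contributesArc 2∤t))
  (indicator-cong (contributesArc? t a j i) (follows? a j i) (odd-contributesArc 2∤t))
... | yes 2∣t = trans (+-comm [ contributesArc? t a i j ] [ contributesArc? t a j i ]) (cong₂ _+_
  (indicator-cong (contributesArc? t a j i) (follows? a i j) (even-contributesArc 2∣t))
  (indicator-cong (contributesArc? t a i j) (follows? a j i) (even-contributesArc 2∣t)))

follows-suc : ∀ a i j → [ follows? a (suc i) (suc j) ] ≡ [ follows? a i j ]
follows-suc a i j = indicator-cong (follows? a (suc i) (suc j)) (follows? a i j)
  (mk⇔ (λ { (s≤s p , s≤s q) → p , q }) (λ { (p , q) → s≤s p , s≤s q }))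

count-< : ∀ n a → sum {n} (λ u → [ toℕ u <? a ]) ≡ a ⊓ n
count-< zero    a       = sym (⊓-zeroʳ a)
count-< (suc n) zero    = sum-replicate-zero (suc n)
count-< (suc n) (suc a) = cong suc (count-< n a)

count-successors : ∀ {n} a (v : Fin n) →
  sum {n} (λ u → [ follows? a (toℕ v) (toℕ u) ]) ≡ a ⊓ (n ∸ index v)
count-successors {suc n} a zero = trans
  (sum-cong-≗ λ (u : Fin n) → indicator-cong (follows? a 0 (index u)) (toℕ u <? a)
    (mk⇔ (λ { (_ , p) → p }) (λ p → s≤s z≤n , p)))
  (count-< n a)
count-successors {suc n} a (suc v) = trans
  (sum-cong-≗ λ (u : Fin n) → follows-suc a (toℕ v) (toℕ u))
  (count-successors a v)

-- Passing from `x` to `suc x` available vertices raises the truncated count by one exactly while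
-- `x < a`. The extra vertex will be the farthest predecessor.
[<]+⊓ : ∀ x a → [ x <? a ] + a ⊓ x ≡ a ⊓ suc x
[<]+⊓ zero    zero          = refl
[<]+⊓ zero    (suc zero)    = refl
[<]+⊓ zero    (suc (suc a)) = refl
[<]+⊓ (suc x) zero          = refl
[<]+⊓ (suc x) (suc a)       = trans (+-suc [ x <? a ] (a ⊓ x)) (cong suc ([<]+⊓ x a))

count-predecessors : ∀ {n} a (v : Fin n) →
  sum {n} (λ u → [ follows? a (toℕ u) (toℕ v) ]) ≡ a ⊓ toℕ v
count-predecessors {suc n} a zero    = trans (sum-replicate-zero (suc n)) (sym (⊓-zeroʳ a))
count-predecessors {suc n} a (suc v) = trans
  (cong₂ _+_
    (indicator-cong (follows? a 0 (index v)) (toℕ v <? a) (mk⇔ (λ { (_ , p) → p }) (λ p → s≤s z≤n , p)))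
    (trans
      (sum-cong-≗ λ (u : Fin n) → follows-suc a (toℕ u) (toℕ v))
      (count-predecessors a v)))
  ([<]+⊓ (toℕ v) a)

-- The degree formula and the extremal degrees.

module _ {l} (s : OrderedString l) where

  total : ℕ
  total = sum (lookup s)

  -- The function f of the opening comment: what a side with `x` vertices adds to a degree.
  truncatedTotal : ℕ → ℕ
  truncatedTotal x = sum λ t → lookup s t ⊓ x

  truncatedTotal-mono : ∀ {x y} → x ≤ y → truncatedTotal x ≤ truncatedTotal y
  truncatedTotal-mono x≤y = sum-mono-≤ λ t → ⊓-monoʳ-≤ (lookup s t) x≤y

  truncatedTotal≤total : ∀ x → truncatedTotal x ≤ total
  truncatedTotal≤total x = sum-mono-≤ λ t → m⊓n≤m (lookup s t) x

  truncatedTotal-0 : truncatedTotal 0 ≡ 0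
  truncatedTotal-0 = trans
    (sum-cong-≗ λ t → ⊓-zeroʳ (lookup s t))
    (sum-replicate-zero l)

  -- No entry exceeds the sum of all entries, so truncation at `total` changes none of them.
  truncatedTotal-total : truncatedTotal total ≡ total
  truncatedTotal-total =
    sum-cong-≗ λ t → m≤n⇒m⊓n≡m (term≤sum (lookup s) t)

  truncatedTotal-subadditive : ∀ x y → truncatedTotal (x + y) ≤ truncatedTotal x + truncatedTotal y
  truncatedTotal-subadditive x y = ≤-trans
    (sum-mono-≤ λ t → ⊓-subadditiveʳ (lookup s t) x y)
    (≤-reflexive (∑-distrib-+ (λ t → lookup s t ⊓ x) (λ t → lookup s t ⊓ y)))

  truncatedTotal-saturated : ∀ {x y} → x ≤ y → total ≤ truncatedTotal x → truncatedTotal y ≡ total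
  truncatedTotal-saturated {x} {y} x≤y M≤fx =
    ≤-antisym (truncatedTotal≤total y) (≤-trans M≤fx (truncatedTotal-mono x≤y))

  -- Out- and in-arcs are paired at each vertex `u` before the sums over vertices and entries are
  -- exchanged, since only the pair is independent of parity.
  degree-O : ∀ {n} (v : Fin n) →
    degree (O n s) v ≡ truncatedTotal (toℕ v) + truncatedTotal (n ∸ index v)
  degree-O {n} v = begin
    sum (λ u → sum (arc v u)) + sum (λ u → sum (arc u v))
      ≡⟨ ∑-distrib-+ (λ u → sum (arc v u)) (λ u → sum (arc u v)) ⟨
    sum (λ u → sum (arc v u) + sum (arc u v))
      ≡⟨ sum-cong-≗ (λ u → sym (∑-distrib-+ (arc v u) (arc u v))) ⟩
    sum (λ u → sum λ t → arc v u t + arc u v t)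
      ≡⟨ ∑-comm (λ u t → arc v u t + arc u v t) ⟩
    sum (λ t → sum λ u → arc v u t + arc u v t)
      ≡⟨ sum-cong-≗ entry ⟩
    sum (λ t → lookup s t ⊓ toℕ v + lookup s t ⊓ (n ∸ index v))
      ≡⟨ ∑-distrib-+ (λ t → lookup s t ⊓ toℕ v) (λ t → lookup s t ⊓ (n ∸ index v)) ⟩
    truncatedTotal (toℕ v) + truncatedTotal (n ∸ index v) ∎
    where
    open ≡-Reasoning

    arc : Fin n → Fin n → Fin l → ℕ
    arc u w t = [ contributesArc? (index t) (lookup s t) (index u) (index w) ]

    entry : ∀ t → sum (λ (u : Fin n) → arc v u t + arc u v t) ≡ lookup s t ⊓ toℕ v + lookup s t ⊓ (n ∸ index v)
    entry t = begin
      sum (λ (u : Fin n) → arc v u t + arc u v t)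
        -- Vertices are numbered from 1 and `toℕ` counts from 0; shift invariance reconciles the
        -- two.
        ≡⟨ sum-cong-≗ (λ (u : Fin n) → trans
             (arcs-between (index t) a (index v) (index u))
             (cong₂ _+_ (follows-suc a (toℕ v) (toℕ u)) (follows-suc a (toℕ u) (toℕ v)))) ⟩
      sum (λ (u : Fin n) → [ follows? a (toℕ v) (toℕ u) ] + [ follows? a (toℕ u) (toℕ v) ])
        ≡⟨ ∑-distrib-+ (λ (u : Fin n) → [ follows? a (toℕ v) (toℕ u) ]) (λ (u : Fin n) → [ follows? a (toℕ u) (toℕ v) ]) ⟩
      sum (λ (u : Fin n) → [ follows? a (toℕ v) (toℕ u) ]) + sum (λ (u : Fin n) → [ follows? a (toℕ u) (toℕ v) ])
        ≡⟨ cong₂ _+_ (count-successors a v) (count-predecessors a v) ⟩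
      a ⊓ (n ∸ index v) + a ⊓ toℕ v
        ≡⟨ +-comm (a ⊓ (n ∸ index v)) (a ⊓ toℕ v) ⟩
      a ⊓ toℕ v + a ⊓ (n ∸ index v) ∎
      where a = lookup s t

  degree-O≤2total : ∀ {n} (v : Fin n) → degree (O n s) v ≤ total + total
  degree-O≤2total v = ≤-trans (≤-reflexive (degree-O v))
    (+-mono-≤ (truncatedTotal≤total _) (truncatedTotal≤total _))

  -- In the graph of order 2M + 1 the middle vertex has at least M ≥ max aₜ vertices on
  -- either side.
  2total≤maxPossibleDegree : ∀ {D} → IsMaxPossibleDegree s D → total + total ≤ D
  2total≤maxPossibleDegree {D} isMax = begin
    total + total                                          ≡⟨ cong₂ _+_ left right ⟨
    truncatedTotal (toℕ m) + truncatedTotal (N ∸ index m)  ≡⟨ degree-O m ⟨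
    degree (O N s) m                                       ≤⟨ foldr₁-⊔-upper (degree (O N s)) m ⟩
    Δ (O N s)                                              ≤⟨ IsMaxPossibleDegree.bound isMax N ⟩
    D                                                      ∎
    where
    open ≤-Reasoning
    N = suc (total + total)

    m : Fin N
    m = fromℕ< {total} (s≤s (m≤m+n total total))

    toℕ-m : toℕ m ≡ total
    toℕ-m = toℕ-fromℕ< (s≤s (m≤m+n total total))

    left : truncatedTotal (toℕ m) ≡ total
    left = trans (cong truncatedTotal toℕ-m) truncatedTotal-total

    right : truncatedTotal (N ∸ index m) ≡ total
    right = trans
      (cong truncatedTotal (trans (cong (total + total ∸_) toℕ-m) (m+n∸n≡m total total)))
      truncatedTotal-total

  Δ-O : ∀ {n} (v : Fin (suc n)) → truncatedTotal (toℕ v) ≡ total → truncatedTotal (n ∸ toℕ v) ≡ total →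
    Δ (O (suc n) s) ≡ total + total
  Δ-O {n} v left right = ≤-antisym
    (foldr₁-⊔-least (degree (O (suc n) s)) degree-O≤2total)
    (≤-trans (≤-reflexive (sym (trans (degree-O v) (cong₂ _+_ left right)))) (foldr₁-⊔-upper (degree (O (suc n) s)) v))

  δ-O : ∀ {n} → truncatedTotal n ≡ total → δ (O (suc n) s) ≡ total
  δ-O {n} fn≡M = ≤-antisym
    (≤-trans (foldr₁-⊓-lower (degree (O (suc n) s)) zero)
      (≤-reflexive (trans (degree-O {suc n} zero) (cong₂ _+_ truncatedTotal-0 fn≡M))))
    (foldr₁-⊓-greatest (degree (O (suc n) s)) total≤degree)
    where
    open ≤-Reasoning
    total≤degree : ∀ v → total ≤ degree (O (suc n) s) v
    total≤degree v = begin
      total                                                ≡⟨ fn≡M ⟨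
      truncatedTotal n                                     ≡⟨ cong truncatedTotal (m+[n∸m]≡n (≤-pred (toℕ<n v))) ⟨
      truncatedTotal (toℕ v + (n ∸ toℕ v))                 ≤⟨ truncatedTotal-subadditive (toℕ v) (n ∸ toℕ v) ⟩
      truncatedTotal (toℕ v) + truncatedTotal (n ∸ toℕ v)  ≡⟨ degree-O v ⟨
      degree (O (suc n) s) v                               ∎

-- From the Kyle graph to larger orders.

+-tightˡ : ∀ {m x y} → m + m ≤ x + y → y ≤ m → m ≤ x
+-tightˡ {m} {x} {y} m+m≤x+y y≤m = +-cancelʳ-≤ m m x (≤-trans m+m≤x+y (+-monoʳ-≤ x y≤m))

corollary2p13 : ∀ {l} .⦃ _ : NonZero l ⦄ (s : OrderedString l) (k : ℕ) → IsKyleOrder s k →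
    ∀ (n : ℕ) .⦃ _ : NonZero n ⦄ → k ≤ n → Δ (O n s) ≡ 2 * δ (O n s)
corollary2p13 s k kyle n@(suc n-1) k≤n with IsKyleOrder.attained kyle
... | v , deg≡D = begin
  Δ (O n s)          ≡⟨ Δ-O s w (saturated (≤-reflexive (sym toℕ-w)) left) (saturated k∸v≤n∸w right) ⟩
  total s + total s  ≡⟨ cong (total s +_) (+-identityʳ (total s)) ⟨
  -- At most `n-1` vertices precede `w`, so saturation on its left gives saturation at `n-1`.
  2 * total s        ≡⟨ cong (2 *_) (δ-O s (saturated (≤-trans (≤-reflexive (sym toℕ-w)) (≤-pred (toℕ<n w))) left)) ⟨
  2 * δ (O n s)      ∎
  where
  open ≡-Reasoning
  saturated : ∀ {x y} → x ≤ y → total s ≤ truncatedTotal s x → truncatedTotal s y ≡ total s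
  saturated = truncatedTotal-saturated s

  -- The vertex with the same number as `v`: its left side keeps its size and its right side can
  -- only grow.
  w : Fin n
  w = inject≤ v k≤n

  toℕ-w : toℕ w ≡ toℕ v
  toℕ-w = toℕ-inject≤ v k≤n

  k∸v≤n∸w : k ∸ index v ≤ n-1 ∸ toℕ w
  k∸v≤n∸w = subst (λ i → k ∸ index v ≤ n-1 ∸ i) (sym toℕ-w) (∸-monoˡ-≤ (index v) k≤n)

  2M≤deg : total s + total s ≤ truncatedTotal s (toℕ v) + truncatedTotal s (k ∸ index v)
  2M≤deg = subst (total s + total s ≤_) (trans (sym deg≡D) (degree-O s v))
    (2total≤maxPossibleDegree s (IsKyleOrder.isMaxPossibleDegree kyle))

  -- Neither side can supply more than `total s`, so a degree of at least twice that saturates both.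
  left : total s ≤ truncatedTotal s (toℕ v)
  left = +-tightˡ 2M≤deg (truncatedTotal≤total s _)

  right : total s ≤ truncatedTotal s (k ∸ index v)
  right = +-tightˡ (subst (total s + total s ≤_) (+-comm (truncatedTotal s (toℕ v)) _) 2M≤deg)
    (truncatedTotal≤total s _)
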